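{- A first-order formula is equivalent to an $\mathcal{L}(\circ)$-formula if and only if it is invariant under $\circ$-bisimulation. That is, for every first-order formula $\alpha=\alpha(x)$ with at most one free variable $x$ in the first-order correspondence language: there is $\psi\in\mathcal{L}(\circ)$ such that for all pointed models $(\mathcal{M},s)$, $\mathcal{M},s\vDash\alpha$ iff $\mathcal{M},s\vDash\psi$, if and only if for all pointed models $(\mathcal{M},s)$ and $(\mathcal{N},t)$ that are $\circ$-bisimilar, $\mathcal{M},s\vDash\alpha$ iff $\mathcal{N},t\vDash\alpha$.
   Context: Let $\mathbf{P}$ be a nonempty set of propositional variables. The language $\mathcal{L}(\circ)$ is given by $\phi::=p\mid\neg\phi\mid(\phi\land\phi)\mid\circ\phi$ with $p\in\mathbf{P}$. A model is $\mathcal{M}=\langle S,R,V\rangle$ with $S$ a nonempty set, $R\subseteq S\times S$, and $V:\mathbf{P}\to\mathcal{P}(S)$; a pointed model $(\mathcal{M},s)$ is a model with a designated $s\in S$. Satisfaction: $\mathcal{M},s\vDash p$ iff $s\in V(p)$; Booleans as usual; $\mathcal{M},s\vDash\circ\phi$ iff ($\mathcal{M},s\vDash\phi$ implies that $\mathcal{M},t\vDash\phi$ for all $t$ with $sRt$). The first-order correspondence language has equality, a binary predicate symbol (interpreted by $R$) and a unary predicate symbol for each $p\in\mathbf{P}$ (interpreted by $V(p)$). For a formula $\alpha(x)$ of this language, $\mathcal{M},s\vDash\alpha$ means that $\alpha$ holds in $\mathcal{M}$, viewed as a first-order structure, when $x$ is assigned $s$. A nonempty binary relation $Z$ over $S$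 is a $\circ$-bisimulation on $\mathcal{M}=\langle S,R,V\rangle$ if $sZs'$ implies: (Inv) for all $p\in\mathbf{P}$, $s\in V(p)$ iff $s'\in V(p)$; ($\circ$-Forth) if $sRt$ and $(s,t)\notin Z$, then there is $t'$ with $s'Rt'$ and $tZt'$; ($\circ$-Back) if $s'Rt'$ and $(s',t')\notin Z$, then there is $t$ with $sRt$ and $tZt'$. Pointed models $(\mathcal{M},s)$ and $(\mathcal{M}',s')$ are $\circ$-bisimilar if there is a $\circ$-bisimulation $Z$ on the disjoint union of $\mathcal{M}$ and $\mathcal{M}'$ with $sZs'$. -}

module Defs where

open import Level using (Level; suc)
open import Data.Fin.Base using (Fin)
open import Data.Nat.Base as ℕ using (ℕ)
open import Data.Product.Base using (∃; ∃-syntax; ∃₂; _×_)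
open import Data.Sum.Base using (_⊎_; inj₁; inj₂; [_,_]′)
open import Data.Sum.Relation.Binary.Pointwise using (Pointwise)
open import Data.Vec.Base using (Vec; []; _∷_; lookup)
open import Function.Bundles using (_⇔_)
open import Relation.Binary.Core using (Rel)
open import Relation.Binary.PropositionalEquality.Core using (_≡_)
open import Relation.Nullary.Negation.Core using (¬_)
open import Relation.Unary using (Pred)

private
  variable ℓ : Level

infix  4 _,_⊨_ _,_⊨ᶠ_
infixr 6 _∧̇_
infix  7 ¬̇_ ∘̇_ ∀̇_
infix  8 _≐_

data Form (P : Set ℓ) : Set ℓ where
  var  : P → Form P
  ¬̇_   : Form P → Form P
  _∧̇_  : Form P → Form P → Form P
  ∘̇_   : Form P → Form P

record Model (P : Set ℓ) : Set (suc ℓ) where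
  field
    S        : Set ℓ
    nonempty : S
    R        : Rel S ℓ
    V        : P → Pred S ℓ

open Model

_,_⊨_ : {P : Set ℓ} (M : Model P) → S M → Form P → Set ℓ
M , s ⊨ var p  = V M p s
M , s ⊨ ¬̇ φ    = ¬ (M , s ⊨ φ)
M , s ⊨ φ ∧̇ ψ  = (M , s ⊨ φ) × (M , s ⊨ ψ)
M , s ⊨ ∘̇ φ    = M , s ⊨ φ → ∀ t → R M s t → M , t ⊨ φ

-- First-order formulas whose free variables are among n de Bruijn indices.
-- The remaining connectives and ∃ are the usual classical abbreviations.
data FO (P : Set ℓ) (n : ℕ) : Set ℓ where
  _≐_  : Fin n → Fin n → FO P n
  rel  : Fin n → Fin n → FO P n
  pred : P → Fin n → FO P n
  ¬̇_   : FO P n → FO P n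
  _∧̇_  : FO P n → FO P n → FO P n
  ∀̇_   : FO P (ℕ.suc n) → FO P n

Holds : {P : Set ℓ} {n : ℕ} (M : Model P) → Vec (S M) n → FO P n → Set ℓ
Holds M ρ (i ≐ j)    = lookup ρ i ≡ lookup ρ j
Holds M ρ (rel i j)  = R M (lookup ρ i) (lookup ρ j)
Holds M ρ (pred p i) = V M p (lookup ρ i)
Holds M ρ (¬̇ α)      = ¬ Holds M ρ α
Holds M ρ (α ∧̇ β)    = Holds M ρ α × Holds M ρ β
Holds M ρ (∀̇ α)      = ∀ a → Holds M (a ∷ ρ) α

_,_⊨ᶠ_ : {P : Set ℓ} (M : Model P) → S M → FO P 1 → Set ℓ
M , s ⊨ᶠ α = Holds M (s ∷ []) α

record IsBisimulation {P : Set ℓ} (M : Model P) (Z : Rel (S M) ℓ) : Set ℓ where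
  field
    nonempty : ∃₂ Z
    inv      : ∀ {s s′} → Z s s′ → ∀ p → V M p s ⇔ V M p s′
    forth    : ∀ {s s′} → Z s s′ → ∀ {t} → R M s t → ¬ Z s t →
               ∃[ t′ ] R M s′ t′ × Z t t′
    back     : ∀ {s s′} → Z s s′ → ∀ {t′} → R M s′ t′ → ¬ Z s′ t′ →
               ∃[ t ] R M s t × Z t t′

_⊎ᴹ_ : {P : Set ℓ} → Model P → Model P → Model P
M ⊎ᴹ N = record
  { S        = S M ⊎ S N
  ; nonempty = inj₁ (nonempty M)
  ; R        = Pointwise (R M) (R N)
  ; V        = λ p → [ V M p , V N p ]′
  }

Bisimilar : {P : Set ℓ} (M : Model P) → S M → (N : Model P) → S N → Set (suc ℓ)
Bisimilar M s N t =
  ∃ λ Z → IsBisimulation (M ⊎ᴹ N) Z × Z (inj₁ s) (inj₂ t)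

EquivalentTo : {P : Set ℓ} → FO P 1 → Form P → Set (suc ℓ)
EquivalentTo {P = P} α ψ =
  ∀ (M : Model P) (s : S M) → (M , s ⊨ᶠ α) ⇔ (M , s ⊨ ψ)

BisimulationInvariant : {P : Set ℓ} → FO P 1 → Set (suc ℓ)
BisimulationInvariant {P = P} α =
  ∀ (M : Model P) (s : S M) (N : Model P) (t : S N) →
  Bisimilar M s N t → (M , s ⊨ᶠ α) ⇔ (N , t ⊨ᶠ α)

-- Let α be invariant, and let D n be the finite list of formulas whose
-- agreement is the n-round approximation of ∘-bisimilarity. If some D n
-- determines α, then α is a disjunction of complete types over D n. Otherwise,
-- for every n there is a model with two points that agree on D n but not on α.
-- A Henkin construction turns these approximants into one limit model on
-- constants ρ 0, ρ 1, …: a chain of conditions, each realised in approximants of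
-- arbitrarily high rank, decides all relevant formulas and supplies witnesses.
-- In the limit, "agreement up to depth rank ∸ j, for some j" is a ∘-bisimulation
-- relating two points that disagree on α. The forth clause only asks about
-- successors outside the relation, in particular not related at level 1 + j,
-- which is what the approximants can answer at that level.
module Submission where

open import Defs
open import Level using (suc; Lift; lift; lower)
open import Axiom.ExcludedMiddle using (ExcludedMiddle)
import Data.Fin.Base as Fin
open import Data.List.Base
  using (List; []; _∷_; [_]; _++_; map; foldr; filter; upTo; concatMap; cartesianProductWith)
open import Data.List.Membership.Propositional using (_∈_)
open import Data.List.Membership.Propositional.Properties
  using (∈-++⁺ˡ; ∈-++⁺ʳ; ∈-++⁻; ∈-map⁺; ∈-map⁻; ∈-filter⁺; ∈-filter⁻; ∈-upTo⁺;
         ∈-concatMap⁺; ∈-cartesianProductWith⁺)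
open import Data.List.Relation.Unary.Any using (here; there)
import Data.List.Relation.Unary.Any as Any
open import Data.Nat.Base as ℕ using (ℕ; _≤_; _<_; _⊔_; _∸_; z≤n; s≤s)
import Data.Nat.Properties as ℕ
open import Data.Nat.Induction using (<-wellFounded; Acc; acc)
open import Data.Product.Base using (∃-syntax; ∃₂; _×_; _,_; proj₁; proj₂)
open import Data.Product.Function.NonDependent.Propositional using (_×-⇔_)
open import Data.Sum.Base using (_⊎_; inj₁; inj₂; [_,_]′)
open import Data.Sum.Relation.Binary.Pointwise using (inj₁; inj₂)
open import Data.Vec.Base as Vec using (Vec; []; _∷_; lookup)
open import Function.Base using (id; _∘_)
open import Function.Bundles using (_⇔_; mk⇔; Equivalence)
open import Function.Construct.Composition using (_⇔-∘_)
open import Function.Construct.Identity using (⇔-id)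
open import Function.Construct.Symmetry using (⇔-sym)
open import Function.Related.TypeIsomorphisms using (¬-cong-⇔)
open import Relation.Binary.Core using (Rel)
open import Relation.Binary.PropositionalEquality
  using (_≡_; refl; sym; trans; cong; cong₂; subst; subst₂)
open import Relation.Nullary using (¬_; Dec; yes; no; contradiction)
open import Relation.Nullary.Decidable as Dec
  using (True; toWitness; fromWitness; decidable-stable)

open Model
open Equivalence using (to; from)

em-lower : ∀ {ℓ} → ExcludedMiddle (suc ℓ) → ExcludedMiddle ℓ
em-lower em = Dec.map′ lower lift em

-- Bounded morphisms and bisimulations

record IsBoundedMorphism {ℓ} {P : Set ℓ} (M N : Model P) (f : S M → S N) : Set ℓ where
  field
    homo : ∀ {x y} → R M x y → R N (f x) (f y)
    lifts : ∀ {x y} → R N (f x) y → ∃[ x′ ] R M x x′ × f x′ ≡ y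
    atoms : ∀ {x} p → V M p x ⇔ V N p (f x)

module _ {ℓ} {P : Set ℓ} where

  id-boundedMorphism : (M : Model P) → IsBoundedMorphism M M id
  id-boundedMorphism M = record
    { homo = id ; lifts = λ r → _ , r , refl ; atoms = λ _ → ⇔-id _ }

  inj₁-boundedMorphism : (M N : Model P) → IsBoundedMorphism M (M ⊎ᴹ N) inj₁
  inj₁-boundedMorphism M N = record
    { homo = inj₁ ; lifts = λ { (inj₁ r) → _ , r , refl } ; atoms = λ _ → ⇔-id _ }

  inj₂-boundedMorphism : (M N : Model P) → IsBoundedMorphism N (M ⊎ᴹ N) inj₂
  inj₂-boundedMorphism M N = record
    { homo = inj₂ ; lifts = λ { (inj₂ r) → _ , r , refl } ; atoms = λ _ → ⇔-id _ }

  module _ {M N : Model P} {f : S M → S N} (bm : IsBoundedMorphism M N f) where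
    open IsBoundedMorphism bm

    copair-boundedMorphism : IsBoundedMorphism (M ⊎ᴹ N) N [ f , id ]′
    copair-boundedMorphism = record
      { homo = λ { (inj₁ r) → homo r ; (inj₂ r) → r }
      ; lifts = λ { {inj₁ _} r → let y , r′ , e = lifts r in inj₁ y , inj₁ r′ , e
                  ; {inj₂ _} r → _ , inj₂ r , refl }
      ; atoms = λ { {inj₁ _} p → atoms p ; {inj₂ _} p → ⇔-id _ }
      }

    boundedMorphism-⊨ : ∀ φ {x} → (M , x ⊨ φ) ⇔ (N , f x ⊨ φ)
    boundedMorphism-⊨ (var p)  = atoms p
    boundedMorphism-⊨ (¬̇ φ)    = ¬-cong-⇔ (boundedMorphism-⊨ φ)
    boundedMorphism-⊨ (φ ∧̇ ψ)  = boundedMorphism-⊨ φ ×-⇔ boundedMorphism-⊨ ψ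
    boundedMorphism-⊨ (∘̇ φ) {x} = mk⇔
      (λ h fx⊨φ t r → let y , xRy , e = lifts r in
        subst (N ,_⊨ φ) e (to (boundedMorphism-⊨ φ) (h (from (boundedMorphism-⊨ φ) fx⊨φ) y xRy)))
      (λ h x⊨φ y r → from (boundedMorphism-⊨ φ) (h (to (boundedMorphism-⊨ φ) x⊨φ) (f y) (homo r)))

    -- The proviso of forth and back that the successor be unrelated passes through unchanged, since
    -- relatedness is read off at the images; `lifts` then brings the answer in `N` back to `M`.
    pullback-bisimulation : ∀ {Z} → IsBisimulation N Z → (∃₂ λ x y → Z (f x) (f y)) →
                            IsBisimulation M (λ x y → Z (f x) (f y))
    pullback-bisimulation {Z} bis ne = record
      { nonempty = ne
      ; inv = λ z p → ⇔-sym (atoms p) ⇔-∘ (inv z p ⇔-∘ atoms p)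
      ; forth = λ z r ¬z → let t , r′ , z′ = forth z (homo r) ¬z
                               y , r″ , e = lifts r′
                           in y , r″ , subst (Z _) (sym e) z′
      ; back = λ z r ¬z → let t , r′ , z′ = back z (homo r) ¬z
                              y , r″ , e = lifts r′
                          in y , r″ , subst (λ w → Z w _) (sym e) z′
      }
      where open IsBisimulation bis

  -- `Bisimilar` asks for a relation on the disjoint union. Folding the union onto `N` by
  -- `[ f , id ]′` is a bounded morphism, so a bisimulation living on `N` alone suffices.
  bisimilar-via : {M N : Model P} {f : S M → S N} → IsBoundedMorphism M N f →
                  ∀ {Z} → IsBisimulation N Z → ∀ {s t} → Z (f s) t → Bisimilar M s N t
  bisimilar-via bm bis {s} {t} z =
    _ , pullback-bisimulation (copair-boundedMorphism bm) bis (inj₁ s , inj₂ t , z) , z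

  ≡-bisimulation : (M : Model P) → IsBisimulation M _≡_
  ≡-bisimulation M = record
    { nonempty = nonempty M , nonempty M , refl
    ; inv = λ { refl p → ⇔-id _ }
    ; forth = λ { refl r _ → _ , r , refl }
    ; back = λ { refl r _ → _ , r , refl }
    }

  invariant-boundedMorphism : ∀ α → BisimulationInvariant α →
    {M N : Model P} {f : S M → S N} → IsBoundedMorphism M N f →
    ∀ s → (M , s ⊨ᶠ α) ⇔ (N , f s ⊨ᶠ α)
  invariant-boundedMorphism α invα {N = N} bm s =
    invα _ _ _ _ (bisimilar-via bm (≡-bisimulation N) refl)

  module _ (em : ExcludedMiddle ℓ) where

    bisimulation-⊨ : {M : Model P} {Z : Rel (S M) ℓ} → IsBisimulation M Z →
                     ∀ φ {s s′} → Z s s′ → (M , s ⊨ φ) ⇔ (M , s′ ⊨ φ)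
    bisimulation-⊨ bis (var p) z = IsBisimulation.inv bis z p
    bisimulation-⊨ bis (¬̇ φ) z = ¬-cong-⇔ (bisimulation-⊨ bis φ z)
    bisimulation-⊨ bis (φ ∧̇ ψ) z = bisimulation-⊨ bis φ z ×-⇔ bisimulation-⊨ bis ψ z
    bisimulation-⊨ {M} {Z} bis (∘̇ φ) {s} {s′} z = mk⇔ ⇒ ⇐
      where
      open IsBisimulation bis
      IH : ∀ {x y} → Z x y → (M , x ⊨ φ) ⇔ (M , y ⊨ φ)
      IH = bisimulation-⊨ bis φ
      ⇒ : M , s ⊨ ∘̇ φ → M , s′ ⊨ ∘̇ φ
      ⇒ h s′⊨φ t′ r with em {Z s′ t′}
      -- A successor already related to `s′` inherits `φ` from `s′` itself; `back` is needed only
      -- for unrelated successors.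
      ... | yes z′ = to (IH z′) s′⊨φ
      ... | no ¬z = let t , r′ , z′ = back z r ¬z in to (IH z′) (h (from (IH z) s′⊨φ) t r′)
      ⇐ : M , s′ ⊨ ∘̇ φ → M , s ⊨ ∘̇ φ
      ⇐ h s⊨φ t r with em {Z s t}
      ... | yes z′ = to (IH z′) s⊨φ
      ... | no ¬z = let t′ , r′ , z′ = forth z r ¬z in from (IH z′) (h (to (IH z) s⊨φ) t′ r′)

    bisimilar-⊨ : ∀ {M : Model P} {s N t} → Bisimilar M s N t → ∀ φ → (M , s ⊨ φ) ⇔ (N , t ⊨ φ)
    bisimilar-⊨ {M} {N = N} (Z , bis , z) φ =
      ⇔-sym (boundedMorphism-⊨ (inj₂-boundedMorphism M N) φ) ⇔-∘
      (bisimulation-⊨ bis φ z ⇔-∘ boundedMorphism-⊨ (inj₁-boundedMorphism M N) φ)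

    definable⇒invariant : ∀ α ψ → EquivalentTo α ψ → BisimulationInvariant α
    definable⇒invariant α ψ e M s N t b = ⇔-sym (e N t) ⇔-∘ (bisimilar-⊨ b ψ ⇔-∘ e M s)

-- Finite types

Agree : ∀ {ℓ} {P : Set ℓ} → List (Form P) → (M : Model P) → S M → (N : Model P) → S N → Set ℓ
Agree L M s N t = ∀ φ → φ ∈ L → (M , s ⊨ φ) ⇔ (N , t ⊨ φ)

agree-sym : ∀ {ℓ} {P : Set ℓ} {L} {M : Model P} {s N t} → Agree L M s N t → Agree L N t M s
agree-sym a φ φ∈L = ⇔-sym (a φ φ∈L)

module Types {ℓ} (em : ExcludedMiddle ℓ) {P : Set ℓ} (p₀ : P) where

  -- The language has no constants, so falsum is built from a variable, which exists because `P` is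
  -- nonempty.
  ⊥̇ : Form P
  ⊥̇ = var p₀ ∧̇ ¬̇ var p₀

  types : List (Form P) → List (Form P)
  types []      = [ ¬̇ ⊥̇ ]
  types (φ ∷ L) = map (φ ∧̇_) (types L) ++ map (¬̇ φ ∧̇_) (types L)

  typeOf : ∀ L M s → ∃[ σ ] σ ∈ types L × (M , s ⊨ σ)
  typeOf [] M s = _ , here refl , λ (h , ¬h) → ¬h h
  typeOf (φ ∷ L) M s with typeOf L M s | em {M , s ⊨ φ}
  ... | σ , σ∈ , s⊨σ | yes s⊨φ = _ , ∈-++⁺ˡ (∈-map⁺ _ σ∈) , s⊨φ , s⊨σ
  ... | σ , σ∈ , s⊨σ | no s⊭φ = _ , ∈-++⁺ʳ _ (∈-map⁺ _ σ∈) , s⊭φ , s⊨σ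

  sameType⇒agree : ∀ L {σ M s N t} → σ ∈ types L → M , s ⊨ σ → N , t ⊨ σ → Agree L M s N t
  sameType⇒agree (φ ∷ L) σ∈ s⊨ t⊨ ψ ψ∈ with ∈-++⁻ (map (φ ∧̇_) (types L)) σ∈
  sameType⇒agree (φ ∷ L) _ s⊨ t⊨ ψ ψ∈ | inj₁ σ∈ with ∈-map⁻ _ σ∈ | ψ∈
  ... | _ , _ , refl   | here refl = mk⇔ (λ _ → proj₁ t⊨) (λ _ → proj₁ s⊨)
  ... | _ , τ∈ , refl | there ψ∈′ = sameType⇒agree L τ∈ (proj₂ s⊨) (proj₂ t⊨) ψ ψ∈′
  sameType⇒agree (φ ∷ L) _ s⊨ t⊨ ψ ψ∈ | inj₂ σ∈ with ∈-map⁻ _ σ∈ | ψ∈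
  ... | _ , _ , refl   | here refl =
    mk⇔ (λ h → contradiction h (proj₁ s⊨)) (λ h → contradiction h (proj₁ t⊨))
  ... | _ , τ∈ , refl | there ψ∈′ = sameType⇒agree L τ∈ (proj₂ s⊨) (proj₂ t⊨) ψ ψ∈′

  agree⇒sameType : ∀ L {σ M s N t} → σ ∈ types L → Agree L M s N t → M , s ⊨ σ → N , t ⊨ σ
  agree⇒sameType [] (here refl) _ _ (h , ¬h) = ¬h h
  agree⇒sameType (φ ∷ L) σ∈ a s⊨ with ∈-++⁻ (map (φ ∧̇_) (types L)) σ∈
  ... | inj₁ σ∈′ with _ , τ∈ , refl ← ∈-map⁻ _ σ∈′ =
    to (a _ (here refl)) (proj₁ s⊨) , agree⇒sameType L τ∈ (λ ψ → a ψ ∘ there) (proj₂ s⊨)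
  ... | inj₂ σ∈′ with _ , τ∈ , refl ← ∈-map⁻ _ σ∈′ =
    proj₁ s⊨ ∘ from (a _ (here refl)) , agree⇒sameType L τ∈ (λ ψ → a ψ ∘ there) (proj₂ s⊨)

  ⋁ : List (Form P) → Form P
  ⋁ = foldr (λ φ ψ → ¬̇ (¬̇ φ ∧̇ ¬̇ ψ)) ⊥̇

  ⋁⁺ : ∀ L {M s φ} → φ ∈ L → M , s ⊨ φ → M , s ⊨ ⋁ L
  ⋁⁺ (_ ∷ _) (here refl) s⊨φ (¬φ , _) = ¬φ s⊨φ
  ⋁⁺ (_ ∷ L) (there φ∈) s⊨φ (_ , ¬ψ) = ¬ψ (⋁⁺ L φ∈ s⊨φ)

  ⋁⁻ : ∀ L {M s} → M , s ⊨ ⋁ L → ∃[ φ ] φ ∈ L × (M , s ⊨ φ)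
  ⋁⁻ [] (h , ¬h) = contradiction h ¬h
  ⋁⁻ (φ ∷ L) {M} {s} h with em {M , s ⊨ φ}
  ... | yes s⊨φ = φ , here refl , s⊨φ
  ... | no s⊭φ =
    let ψ , ψ∈ , s⊨ψ = ⋁⁻ L (decidable-stable em λ s⊭L → h (s⊭φ , s⊭L)) in ψ , there ψ∈ , s⊨ψ

  -- The defining formula is the disjunction of those complete types over `L` that are realised
  -- together with `α` somewhere. Realisability quantifies over all models, hence excluded middle
  -- one level up.
  agreement-definable : ExcludedMiddle (suc ℓ) → ∀ (α : FO P 1) L →
    (∀ M s N t → Agree L M s N t → M , s ⊨ᶠ α → N , t ⊨ᶠ α) → ∃[ ψ ] EquivalentTo α ψ
  agreement-definable em⁺ α L pres = ⋁ (filter good? (types L)) , λ M s → mk⇔ (⇒ M s) (⇐ M s)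
    where
    Good : Form P → Set (suc ℓ)
    Good σ = ∃₂ λ M s → (M , s ⊨ σ) × (M , s ⊨ᶠ α)
    good? : ∀ σ → Dec (Good σ)
    good? _ = em⁺
    ⇒ : ∀ M s → M , s ⊨ᶠ α → M , s ⊨ ⋁ (filter good? (types L))
    ⇒ M s h = let σ , σ∈ , s⊨σ = typeOf L M s in
      ⋁⁺ _ (∈-filter⁺ good? σ∈ (M , s , s⊨σ , h)) s⊨σ
    ⇐ : ∀ M s → M , s ⊨ ⋁ (filter good? (types L)) → M , s ⊨ᶠ α
    ⇐ M s h =
      let σ , σ∈f , s⊨σ = ⋁⁻ (filter good? (types L)) h
          σ∈ , N , t , t⊨σ , t⊨α = ∈-filter⁻ good? {xs = types L} σ∈f
      in pres N t M s (sameType⇒agree L σ∈ t⊨σ s⊨σ) t⊨α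

  -- Agreement up to finite depth

  module Depth (Φ : List P) where

    -- `∘̇ ¬̇ σ` fails at a point exactly when the point lacks type `σ` and some successor has it.
    -- So `D (suc n)` records which types over `D n`, other than a point's own, occur among its
    -- successors.
    D : ℕ → List (Form P)
    D ℕ.zero    = map var Φ
    D (ℕ.suc n) = D n ++ map (λ σ → ∘̇ ¬̇ σ) (types (D n))

    var∈D : ∀ n {p} → p ∈ Φ → var p ∈ D n
    var∈D ℕ.zero    p∈Φ = ∈-map⁺ var p∈Φ
    var∈D (ℕ.suc n) p∈Φ = ∈-++⁺ˡ (var∈D n p∈Φ)

    -- Let `σ` be the type of `t` over `D n`. Without an answer, `∘̇ ¬̇ σ` holds at `s′`, hence at
    -- `s`. As `s` disagrees with `t`, it lacks `σ`, and so `t` would lack its own type.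
    agree-forth : ∀ n {M s N s′ t} → Agree (D (ℕ.suc n)) M s N s′ → R M s t →
                  ¬ Agree (D n) M s M t → ∃[ t′ ] R N s′ t′ × Agree (D n) M t N t′
    agree-forth n {M} {s} {N} {s′} {t} a r ¬a with typeOf (D n) M t
    ... | σ , σ∈ , t⊨σ = decidable-stable em λ none →
      from (a _ (∈-++⁺ʳ (D n) (∈-map⁺ (λ σ → ∘̇ ¬̇ σ) σ∈)))
        (λ _ t′ r′ t′⊨σ → none (t′ , r′ , sameType⇒agree (D n) σ∈ t⊨σ t′⊨σ))
        (λ s⊨σ → ¬a (sameType⇒agree (D n) σ∈ s⊨σ t⊨σ))
        t r t⊨σ

-- A Henkin construction on semantic conditions

least : ∀ {ℓ} → ExcludedMiddle ℓ → (Q : ℕ → Set ℓ) → ∀ {a} → Acc _<_ a → Q a →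
        ∃[ b ] Q b × (∀ c → Q c → b ≤ c)
least em Q {a} (acc rs) q with em {∃[ c ] c < a × Q c}
... | yes (c , c<a , qc) = least em Q (rs c<a) qc
... | no none = a , q , λ c qc → ℕ.≮⇒≥ λ c<a → none (c , c<a , qc)

_[_↦_] : ∀ {a} {X : Set a} → (ℕ → X) → ℕ → X → ℕ → X
(ρ [ w ↦ x ]) i with i ℕ.≟ w
... | yes _ = x
... | no _  = ρ i

update-same : ∀ {a} {X : Set a} (ρ : ℕ → X) w x → (ρ [ w ↦ x ]) w ≡ x
update-same ρ w x with w ℕ.≟ w
... | yes _  = refl
... | no w≢w = contradiction refl w≢w

update-below : ∀ {a} {X : Set a} (ρ : ℕ → X) w x {i} → i < w → ρ i ≡ (ρ [ w ↦ x ]) i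
update-below ρ w x {i} i<w with i ℕ.≟ w
... | yes refl = contradiction i<w (ℕ.<-irrefl refl)
... | no _     = refl

bound : ∀ {n} → Vec ℕ n → ℕ
bound []      = 0
bound (a ∷ v) = ℕ.suc a ⊔ bound v

map-cong-below : ∀ {a} {X : Set a} {ρ ρ′ : ℕ → X} {n} (v : Vec ℕ n) →
                 (∀ {i} → i < bound v → ρ i ≡ ρ′ i) → Vec.map ρ v ≡ Vec.map ρ′ v
map-cong-below []      e = refl
map-cong-below (a ∷ v) e = cong₂ _∷_ (e (ℕ.m≤m⊔n (ℕ.suc a) (bound v)))
  (map-cong-below v λ i< → e (ℕ.≤-trans i< (ℕ.m≤n⊔m (ℕ.suc a) (bound v))))

vecs : ∀ n → ℕ → List (Vec ℕ n)
vecs ℕ.zero    k = [ [] ]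
vecs (ℕ.suc n) k = cartesianProductWith _∷_ (upTo k) (vecs n k)

∈-vecs : ∀ {n} (v : Vec ℕ n) {k} → bound v ≤ k → v ∈ vecs n k
∈-vecs []      _  = here refl
∈-vecs (a ∷ v) le = ∈-cartesianProductWith⁺ _∷_
  (∈-upTo⁺ (ℕ.≤-trans (ℕ.m≤m⊔n (ℕ.suc a) (bound v)) le))
  (∈-vecs v (ℕ.≤-trans (ℕ.m≤n⊔m (ℕ.suc a) (bound v)) le))

module Henkin {ℓ} (em : ExcludedMiddle (suc ℓ))
              (𝒜 : Set (suc ℓ)) (Carrier : 𝒜 → Set ℓ) (rank : 𝒜 → ℕ) where

  -- Formulas are replaced by arbitrary predicates on approximants, so that a condition may depend
  -- on the rank of the approximant.
  Fm : ℕ → Set (suc ℓ)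
  Fm n = ∀ A → Vec (Carrier A) n → Set ℓ

  Cond : Set (suc ℓ)
  Cond = ∀ A → (ℕ → Carrier A) → Set ℓ

  Con : Cond → Set (suc ℓ)
  Con Q = ∀ n → ∃[ A ] n ≤ rank A × ∃[ ρ ] Q A ρ

  infix 4 _⊩_
  _⊩_ : Cond → Cond → Set (suc ℓ)
  Q ⊩ B = ∀ A ρ → Q A ρ → B A ρ

  -- `local` confines the condition to the constants below `size`; every later constant is fresh.
  record State : Set (suc ℓ) where
    field
      cond  : Cond
      size  : ℕ
      local : ∀ {A ρ ρ′} → (∀ {i} → i < size → ρ i ≡ ρ′ i) → cond A ρ → cond A ρ′
      con   : Con cond
  open State

  Inst : ∀ {n} → Fm n → Vec ℕ n → Cond
  Inst C v A ρ = C A (Vec.map ρ v)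

  Ex : ∀ {n} → Fm (ℕ.suc n) → Vec ℕ n → Cond
  Ex C v A ρ = ∃[ x ] C A (x ∷ Vec.map ρ v)

  Item : Set (suc ℓ)
  Item = ∃[ n ] Fm (ℕ.suc n) × Vec ℕ n

  Decides : Cond → Item → Set (suc ℓ)
  Decides Q (n , C , v) =
    (∃[ w ] Q ⊩ Inst C (w ∷ v)) ⊎ (Q ⊩ λ A ρ → ¬ Ex C v A ρ)

  decides-mono : ∀ {Q Q′ i} → Q′ ⊩ Q → Decides Q i → Decides Q′ i
  decides-mono Q′⊩Q (inj₁ (w , h)) = inj₁ (w , λ A ρ → h A ρ ∘ Q′⊩Q A ρ)
  decides-mono Q′⊩Q (inj₂ h)       = inj₂ λ A ρ → h A ρ ∘ Q′⊩Q A ρ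

  -- If `Q` with `¬ B` had no realisation of rank at least `n`, every realisation of `Q` from rank
  -- `n` on would satisfy `B`, and `B` would be realised with `Q` at unbounded rank.
  con-refute : ∀ {Q B : Cond} → Con Q → ¬ Con (λ A ρ → Q A ρ × B A ρ) →
               Con (λ A ρ → Q A ρ × ¬ B A ρ)
  con-refute {Q} {B} con ¬con n = decidable-stable em λ none → ¬con λ m →
    let A , n⊔m≤ , ρ , q = con (n ⊔ m) in
    A , ℕ.≤-trans (ℕ.m≤n⊔m n m) n⊔m≤ , ρ , q , decidable-stable (em-lower em) λ ¬b →
    none (A , ℕ.≤-trans (ℕ.m≤m⊔n n m) n⊔m≤ , ρ , q , ¬b)

  decide : ∀ st i → ∃[ st′ ] (cond st′ ⊩ cond st) × Decides (cond st′) i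
  decide st i@(n , C , v) with em {Con (λ A ρ → cond st A ρ × Ex C v A ρ)}
  ... | yes con∃ = record
    { cond  = λ A ρ → cond st A ρ × Inst C (w ∷ v) A ρ
    ; size  = ℕ.suc w
    ; local = λ {A} e (q , c) →
        local st (λ i< → e (ℕ.m≤n⇒m≤1+n (ℕ.≤-trans i< size≤w))) q ,
        subst (C A) (map-cong-below (w ∷ v) λ i< →
          e (ℕ.≤-trans i< (ℕ.⊔-lub ℕ.≤-refl (ℕ.m≤n⇒m≤1+n bound≤w)))) c
    ; con   = λ m → let A , m≤ , ρ , q , x , c = con∃ m in
        A , m≤ , ρ [ w ↦ x ] ,
        local st (λ i< → update-below ρ w x (ℕ.≤-trans i< size≤w)) q ,
        subst (C A) (cong₂ _∷_ (sym (update-same ρ w x))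
          (map-cong-below v λ i< → update-below ρ w x (ℕ.≤-trans i< bound≤w))) c
    } , (λ A ρ → proj₁) , inj₁ (w , λ A ρ → proj₂)
    where
    -- Neither the current condition nor `v` mentions this constant, so it can be reassigned to the
    -- witness in each approximant.
    w = size st ⊔ bound v
    size≤w : size st ≤ w
    size≤w = ℕ.m≤m⊔n (size st) (bound v)
    bound≤w : bound v ≤ w
    bound≤w = ℕ.m≤n⊔m (size st) (bound v)
  ... | no ¬con∃ = record
    { cond  = λ A ρ → cond st A ρ × ¬ Ex C v A ρ
    ; size  = size st ⊔ bound v
    ; local = λ {A} e (q , ¬c) →
        local st (λ i< → e (ℕ.≤-trans i< (ℕ.m≤m⊔n (size st) (bound v)))) q ,
        λ (x , c) → ¬c (x , subst (λ u → C A (x ∷ u))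
          (sym (map-cong-below v λ i< → e (ℕ.≤-trans i< (ℕ.m≤n⊔m (size st) (bound v))))) c)
    ; con   = con-refute (con st) ¬con∃
    } , (λ A ρ → proj₁) , inj₂ (λ A ρ → proj₂)

  decideAll : ∀ st is → ∃[ st′ ] (cond st′ ⊩ cond st) × (∀ {i} → i ∈ is → Decides (cond st′) i)
  decideAll st []       = st , (λ A ρ → id) , λ ()
  decideAll st (i ∷ is) =
    let st₁ , ⊩₁ , d  = decide st i
        st₂ , ⊩₂ , ds = decideAll st₁ is
    in st₂ , (λ A ρ → ⊩₁ A ρ ∘ ⊩₂ A ρ) ,
       λ { (here refl) → decides-mono {i = i} ⊩₂ d ; (there i∈) → ds i∈ }

  -- The chain of stages and truth in the limit

  module Theory (fms : ℕ → List (∃[ n ] Fm (ℕ.suc n))) (start : State) where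

    items : ℕ → List Item
    items k = concatMap (λ (n , C) → map (λ v → n , C , v) (vecs n k)) (fms k)

    stage : ℕ → State
    stage ℕ.zero    = start
    stage (ℕ.suc k) = proj₁ (decideAll (stage k) (items k))

    stage-mono′ : ∀ {m n} → m ℕ.≤′ n → cond (stage n) ⊩ cond (stage m)
    stage-mono′ ℕ.≤′-refl         = λ A ρ → id
    stage-mono′ (ℕ.≤′-step {n} m≤n) = λ A ρ →
      stage-mono′ m≤n A ρ ∘ proj₁ (proj₂ (decideAll (stage n) (items n))) A ρ

    stage-mono : ∀ {m n} → m ≤ n → cond (stage n) ⊩ cond (stage m)
    stage-mono = stage-mono′ ∘ ℕ.≤⇒≤′

    stage-decides : ∀ k i → i ∈ items k → Decides (cond (stage (ℕ.suc k))) i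
    stage-decides k i i∈ = proj₂ (proj₂ (decideAll (stage k) (items k))) {i} i∈

    ∈-items : ∀ {k n v} {C : Fm (ℕ.suc n)} → (n , C) ∈ fms k → bound v ≤ k → (n , C , v) ∈ items k
    ∈-items {k} {n} {v} {C} C∈ v≤k = ∈-concatMap⁺ (λ (n , C) → map (λ v → n , C , v) (vecs n k))
      (Any.map (λ { refl → ∈-map⁺ (λ v → n , C , v) (∈-vecs v v≤k) }) C∈)

    -- Dovetailing: each stage treats finitely many items, and a formula listed from some stage on
    -- meets every parameter tuple `v` once the stage also reaches `bound v`.
    Eventually : ∃[ n ] Fm (ℕ.suc n) → Set (suc ℓ)
    Eventually C = ∃[ k ] (∀ {m} → k ≤ m → C ∈ fms m)

    opaque
      -- Truth in the limit: membership in the filter generated by the stages and the lower bounds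
      -- on rank. It is proper because each stage is realised at unbounded rank, and it decides the
      -- formulas eventually listed.
      T : Cond → Set (suc ℓ)
      T B = ∃[ n ] (∀ A ρ → n ≤ rank A → cond (stage n) A ρ → B A ρ)

      T-start : ∀ {B} → cond start ⊩ B → T B
      T-start h = 0 , λ A ρ _ → h A ρ

      T-rank : ∀ n → T (λ A ρ → Lift ℓ (n ≤ rank A))
      T-rank n = n , λ A ρ n≤ _ → lift n≤

      T-map : ∀ {B C} → B ⊩ C → T B → T C
      T-map B⊩C (n , h) = n , λ A ρ n≤ q → B⊩C A ρ (h A ρ n≤ q)

      T-pure : ∀ {B : Cond} → (∀ A ρ → B A ρ) → T B
      T-pure b = 0 , λ A ρ _ _ → b A ρ

      T-× : ∀ {B C : Cond} → T B → T C → T (λ A ρ → B A ρ × C A ρ)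
      T-× (m , h) (n , g) = m ⊔ n , λ A ρ ≤r q →
        h A ρ (ℕ.≤-trans (ℕ.m≤m⊔n m n) ≤r) (stage-mono (ℕ.m≤m⊔n m n) A ρ q) ,
        g A ρ (ℕ.≤-trans (ℕ.m≤n⊔m m n) ≤r) (stage-mono (ℕ.m≤n⊔m m n) A ρ q)

      T-map₂ : ∀ {B C D : Cond} → (∀ A ρ → B A ρ → C A ρ → D A ρ) → T B → T C → T D
      T-map₂ f b c = T-map (λ A ρ (x , y) → f A ρ x y) (T-× b c)

      T-consistent : ∀ {B : Cond} → T B → ¬ T (λ A ρ → ¬ B A ρ)
      T-consistent b ¬b =
        let n , h = T-× b ¬b
            A , n≤ , ρ , q = con (stage n) n
            x , ¬x = h A ρ n≤ q
        in ¬x x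

      T-decides : ∀ {n} (C : Fm (ℕ.suc n)) → Eventually (n , C) → ∀ v →
                  (∃[ w ] T (Inst C (w ∷ v))) ⊎ T (λ A ρ → ¬ Ex C v A ρ)
      T-decides {n} C (k , ev) v with stage-decides m (n , C , v) item∈
        where
        m : ℕ
        m = k ⊔ bound v
        item∈ : (n , C , v) ∈ items m
        item∈ = ∈-items {C = C} (ev (ℕ.m≤m⊔n k (bound v))) (ℕ.m≤n⊔m k (bound v))
      ... | inj₁ (w , h) = inj₁ (w , _ , λ A ρ _ → h A ρ)
      ... | inj₂ h       = inj₂ (_ , λ A ρ _ → h A ρ)

-- Approximants and the formulas to be decided

preds : ∀ {ℓ} {P : Set ℓ} {n} → FO P n → List P
preds (_ ≐ _)    = []
preds (rel _ _)  = []
preds (pred p _) = [ p ]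
preds (¬̇ β)      = preds β
preds (β ∧̇ γ)    = preds β ++ preds γ
preds (∀̇ β)      = preds β

module Limit {ℓ} (em : ExcludedMiddle (suc ℓ)) {P : Set ℓ} (p₀ : P) (α : FO P 1) where

  Φ : List P
  Φ = preds α

  open Types (em-lower em) p₀
  open Depth Φ

  record Approximant : Set (suc ℓ) where
    field
      rank       : ℕ
      model      : Model P
      left right : S model
      agree      : Agree (D rank) model left model right
      left⊨      : model , left ⊨ᶠ α
      right⊭     : ¬ (model , right ⊨ᶠ α)
  open Approximant

  open Henkin em Approximant (S ∘ model) rank
  open State

  -- Depth is counted down from the rank so that forth leads from W j to W (1 + j).
  -- For j ≥ rank A the subtraction truncates; only j < rank A matters in the limit.
  W : ℕ → Fm 2
  W j A (x ∷ y ∷ []) = Agree (D (rank A ∸ j)) (model A) x (model A) y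

  -- With a dummy quantifier in front, deciding the existential statement decides `C` itself.
  vacuous : ∀ {n} → Fm n → Fm (ℕ.suc n)
  vacuous C A v = C A (Vec.tail v)

  answer : ℕ → Fm 3
  answer j A (t′ ∷ s′ ∷ t ∷ []) = R (model A) s′ t′ × W j A (t ∷ t′ ∷ [])

  holds : ∀ {n} → FO P n → Fm n
  holds β A v = Holds (model A) v β

  -- What the truth lemma uses: each subformula is to be decided, and each universal one gets a
  -- counterexample if it fails.
  subs : ∀ {n} → FO P n → List (∃[ n ] Fm (ℕ.suc n))
  subs {n} β = (n , vacuous (holds β)) ∷ proper β
    where
    proper : ∀ {n} → FO P n → List (∃[ n ] Fm (ℕ.suc n))
    proper (¬̇ β)        = subs β
    proper (β ∧̇ γ)      = subs β ++ subs γ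
    proper {n} (∀̇ β)    = (n , holds (¬̇ β)) ∷ subs β
    proper _            = []

  fms : ℕ → List (∃[ n ] Fm (ℕ.suc n))
  fms k = subs α ++ concatMap (λ j → (2 , vacuous (W j)) ∷ (2 , answer j) ∷ []) (upTo k)

  start : (∀ n → ∃[ A ] n ≤ rank A) → State
  start unbounded = record
    { cond  = λ A ρ → ρ 0 ≡ left A × ρ 1 ≡ right A
    ; size  = 2
    ; local = λ e (l , r) → trans (sym (e (s≤s z≤n))) l , trans (sym (e (s≤s (s≤s z≤n)))) r
    ; con   = λ n → let A , n≤ = unbounded n in
        -- Constants from 2 on take `right A` as a default; the starting condition does not
        -- constrain them.
        A , n≤ , (λ { 0 → left A ; _ → right A }) , refl , refl
    }

  module _ (unbounded : ∀ n → ∃[ A ] n ≤ rank A) where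
    open Theory fms (start unbounded)

    subs-eventually : ∀ {C} → C ∈ subs α → Eventually C
    subs-eventually C∈ = 0 , λ _ → ∈-++⁺ˡ C∈

    W-eventually : ∀ j → Eventually (2 , vacuous (W j))
    W-eventually j = ℕ.suc j , λ j< → ∈-++⁺ʳ (subs α)
      (∈-concatMap⁺ _ (Any.map (λ { refl → here refl }) (∈-upTo⁺ j<)))

    answer-eventually : ∀ j → Eventually (2 , answer j)
    answer-eventually j = ℕ.suc j , λ j< → ∈-++⁺ʳ (subs α)
      (∈-concatMap⁺ _ (Any.map (λ { refl → there (here refl) }) (∈-upTo⁺ j<)))

    T-excluded-middle : ∀ {n} (C : Fm n) → Eventually (n , vacuous C) → ∀ v →
                        T (Inst C v) ⊎ T (λ A ρ → ¬ Inst C v A ρ)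
    T-excluded-middle C ev v with T-decides (vacuous C) ev v
    ... | inj₁ (w , t) = inj₁ t
    ... | inj₂ t       = inj₂ (T-map (λ A ρ ¬c c → ¬c (ρ 0 , c)) t)

    -- The limit model on canonical constants

    Eq : ℕ → ℕ → Cond
    Eq a b A ρ = ρ a ≡ ρ b

    opaque
      -- The least constant equal to `a` in the limit is a normal form for its class, so the carrier
      -- consists of normal forms instead of a quotient.
      leastEqual : ∀ a → ∃[ b ] T (Eq b a) × (∀ c → T (Eq c a) → b ≤ c)
      leastEqual a = least em (λ b → T (Eq b a)) (<-wellFounded a) (T-pure λ A ρ → refl)

    rep : ℕ → ℕ
    rep a = proj₁ (leastEqual a)

    rep-Eq : ∀ a → T (Eq (rep a) a)
    rep-Eq a = proj₁ (proj₂ (leastEqual a))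

    rep-mono : ∀ {a b} → T (Eq a b) → rep a ≤ rep b
    rep-mono {a} {b} e = proj₂ (proj₂ (leastEqual a)) (rep b)
      (T-map₂ (λ A ρ x y → trans x (sym y)) (rep-Eq b) e)

    rep-cong : ∀ {a b} → T (Eq a b) → rep a ≡ rep b
    rep-cong e = ℕ.≤-antisym (rep-mono e) (rep-mono (T-map (λ A ρ → sym) e))

    -- `T` lives one universe above the relations of a model; excluded middle reduces it to a truth
    -- value, which fits at level `ℓ`.
    Small : Set (suc ℓ) → Set ℓ
    Small X = Lift ℓ (True (em {X}))

    small⁺ : ∀ {X} → X → Small X
    small⁺ x = lift (fromWitness x)

    small⁻ : ∀ {X} → Small X → X
    small⁻ (lift x) = toWitness x

    Point : Set ℓ
    Point = Lift ℓ (∃[ a ] rep a ≡ a)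

    ix : Point → ℕ
    ix (lift (a , _)) = a

    ix-injective : ∀ {x y} → ix x ≡ ix y → x ≡ y
    ix-injective {lift (a , e)} {lift (.a , e′)} refl = cong (λ e → lift (a , e)) (ℕ.≡-irrelevant e e′)

    cls : ℕ → Point
    cls a = lift (rep a , rep-cong (rep-Eq a))

    cls-ix : ∀ x → cls (ix x) ≡ x
    cls-ix (lift (_ , e)) = ix-injective e

    Eq⇒≡ : ∀ {x y} → T (Eq (ix x) (ix y)) → x ≡ y
    Eq⇒≡ {lift (_ , e)} {lift (_ , e′)} t = ix-injective (trans (sym e) (trans (rep-cong t) e′))

    lookup-cls : ∀ {n} (v : Vec ℕ n) i →
                 T (λ A ρ → ρ (ix (lookup (Vec.map cls v) i)) ≡ lookup (Vec.map ρ v) i)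
    lookup-cls (a ∷ v) Fin.zero    = rep-Eq a
    lookup-cls (a ∷ v) (Fin.suc i) = lookup-cls v i

    limit : Model P
    limit = record
      { S        = Point
      ; nonempty = cls 0
      ; R        = λ x y → Small (T λ A ρ → R (model A) (ρ (ix x)) (ρ (ix y)))
      -- Variables not occurring in `α` are false everywhere, since the lists `D n` control only
      -- those in `Φ`.
      ; V        = λ p x → p ∈ Φ × Small (T λ A ρ → V (model A) p (ρ (ix x)))
      }

    Holdsᵀ : ∀ {n} → Vec ℕ n → FO P n → Set (suc ℓ)
    Holdsᵀ v β = T (Inst (holds β) v)

    -- The Henkin truth lemma, restricted to subformulas of `α` because only these are guaranteed to
    -- be decided. Negation uses that decision, and the universal case the witness for `¬̇ β`.
    truth : ∀ {n} (β : FO P n) → (∀ {p} → p ∈ preds β → p ∈ Φ) →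
            (∀ {C} → C ∈ subs β → C ∈ subs α) →
            ∀ v → Holds limit (Vec.map cls v) β ⇔ Holdsᵀ v β
    truth (i ≐ j) _ _ v = mk⇔
      (λ e → T-map₂ (λ A ρ x y → trans (sym x) (trans (cong (ρ ∘ ix) e) y))
                    (lookup-cls v i) (lookup-cls v j))
      (λ t → Eq⇒≡ (T-map₂ (λ A ρ (x , y) e → trans x (trans e (sym y)))
                          (T-× (lookup-cls v i) (lookup-cls v j)) t))
    truth (rel i j) _ _ v = mk⇔
      (λ r → T-map₂ (λ A ρ (x , y) → subst₂ (R (model A)) x y)
                    (T-× (lookup-cls v i) (lookup-cls v j)) (small⁻ r))
      (λ t → small⁺ (T-map₂ (λ A ρ (x , y) → subst₂ (R (model A)) (sym x) (sym y))
                            (T-× (lookup-cls v i) (lookup-cls v j)) t))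
    truth (pred p i) p∈ _ v = mk⇔
      (λ (_ , h) → T-map₂ (λ A ρ → subst (V (model A) p)) (lookup-cls v i) (small⁻ h))
      (λ t → p∈ (here refl) ,
             small⁺ (T-map₂ (λ A ρ → subst (V (model A) p) ∘ sym) (lookup-cls v i) t))
    truth (¬̇ β) p∈ sub v = mk⇔ ⇒ (λ t h → T-consistent (to IH h) t)
      where
      IH = truth β p∈ (sub ∘ there) v
      ⇒ : ¬ Holds limit (Vec.map cls v) β → Holdsᵀ v (¬̇ β)
      ⇒ ¬h with T-excluded-middle (holds β) (subs-eventually (sub (there (here refl)))) v
      ... | inj₁ t  = contradiction (from IH t) ¬h
      ... | inj₂ ¬t = ¬t
    truth (β ∧̇ γ) p∈ sub v = mk⇔
      (λ (b , c) → T-× (to IHβ b) (to IHγ c))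
      (λ t → from IHβ (T-map (λ A ρ → proj₁) t) , from IHγ (T-map (λ A ρ → proj₂) t))
      where
      IHβ = truth β (p∈ ∘ ∈-++⁺ˡ) (sub ∘ there ∘ ∈-++⁺ˡ) v
      IHγ = truth γ (p∈ ∘ ∈-++⁺ʳ (preds β)) (sub ∘ there ∘ ∈-++⁺ʳ (subs β)) v
    truth (∀̇ β) p∈ sub v = mk⇔ ⇒
      (λ t x → subst (λ x → Holds limit (x ∷ Vec.map cls v) β) (cls-ix x)
                     (from (IH (ix x)) (T-map (λ A ρ h → h (ρ (ix x))) t)))
      where
      IH : ∀ a → Holds limit (cls a ∷ Vec.map cls v) β ⇔ Holdsᵀ (a ∷ v) β
      IH a = truth β p∈ (sub ∘ there ∘ there) (a ∷ v)
      ⇒ : (∀ x → Holds limit (x ∷ Vec.map cls v) β) → Holdsᵀ v (∀̇ β)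
      ⇒ h with T-decides (holds (¬̇ β)) (subs-eventually (sub (there (here refl)))) v
      ... | inj₁ (w , t) = contradiction t (T-consistent (to (IH w) (h (cls w))))
      ... | inj₂ t = T-map (λ A ρ none x → decidable-stable (em-lower em) λ ¬b → none (x , ¬b)) t

    -- The bisimulation on the limit model

    Z : Rel Point ℓ
    Z x y = Small (∃[ j ] T (Inst (W j) (ix x ∷ ix y ∷ [])))

    Z-sym : ∀ x y → Z x y → Z y x
    Z-sym x y z = let j , t = small⁻ z in small⁺ (j , T-map (λ A ρ → agree-sym) t)

    Z-forth : ∀ s s′ t → Z s s′ → R limit s t → ¬ Z s t →
              ∃[ t′ ] R limit s′ t′ × Z t t′
    Z-forth s s′ t z r ¬z
      with j , related ← small⁻ z
      -- `¬ Z s t` rules out every level; level `1 + j` is the one at which `agree-forth` applies,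
      -- and deciding it makes the disagreement true in the limit.
      with T-excluded-middle (W (ℕ.suc j)) (W-eventually (ℕ.suc j)) (ix s ∷ ix t ∷ [])
    ... | inj₁ w = contradiction (small⁺ (ℕ.suc j , w)) ¬z
    ... | inj₂ ¬w with T-decides (answer (ℕ.suc j)) (answer-eventually (ℕ.suc j)) (ix s′ ∷ ix t ∷ [])
    -- The witness `a` need not be a normal form; `rep-Eq a` moves both properties to its
    -- representative.
    ...   | inj₁ (a , h) =
      cls a ,
      small⁺ (T-map₂ (λ A ρ e (r , _) → subst (R (model A) (ρ (ix s′))) (sym e) r) (rep-Eq a) h) ,
      small⁺ (ℕ.suc j , T-map₂ (λ A ρ e (_ , w) → subst (λ y → W (ℕ.suc j) A (ρ (ix t) ∷ y ∷ [])) (sym e) w)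
                               (rep-Eq a) h)
    ...   | inj₂ none = contradiction none (T-consistent (T-map₂
      -- `rank A ∸ j` is the successor of `rank A ∸ suc j` only when `j < rank A`, which `T-rank`
      -- supplies in the limit.
      (λ A ρ (lift j< , w) (r , ¬w) → agree-forth (rank A ∸ ℕ.suc j)
        (subst (λ m → Agree (D m) (model A) (ρ (ix s)) (model A) (ρ (ix s′))) (ℕ.+-∸-assoc 1 j<) w) r ¬w)
      (T-× (T-rank (ℕ.suc j)) related) (T-× (small⁻ r) ¬w)))

    Z-bisimulation : Z (cls 0) (cls 1) → IsBisimulation limit Z
    Z-bisimulation z = record
      { nonempty = cls 0 , cls 1 , z
      ; inv      = λ {s} {s′} z p → mk⇔ (inv s s′ z p) (inv s′ s (Z-sym s s′ z) p)
      ; forth    = λ {s} {s′} z {t} → Z-forth s s′ t z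
      ; back     = λ {s} {s′} z {t′} r ¬z →
          let t , r′ , z′ = Z-forth s′ s t′ (Z-sym s s′ z) r ¬z in t , r′ , Z-sym t′ t z′
      }
      where
      inv : ∀ x y → Z x y → ∀ p → V limit p x → V limit p y
      inv x y z p (p∈ , h) = let j , w = small⁻ z in
        -- Every depth, even 0, includes the variables of `Φ`, so the level `j` does not matter
        -- here.
        p∈ , small⁺ (T-map₂ (λ A ρ w → to (w _ (var∈D (rank A ∸ j) p∈))) w (small⁻ h))

    -- Level 0 is the full depth `rank A`, at which every approximant has its two endpoints agree.
    start-related : Z (cls 0) (cls 1)
    start-related = small⁺ (0 , T-map₂
      (λ A ρ (e₀ , e₁) (l , r) → W-endpoints A (trans e₀ l) (trans e₁ r))
      (T-× (rep-Eq 0) (rep-Eq 1)) (T-start λ A ρ → id))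
      where
      W-endpoints : ∀ A {x y} → x ≡ left A → y ≡ right A → W 0 A (x ∷ y ∷ [])
      W-endpoints A refl refl = agree A

    not-invariant : ¬ BisimulationInvariant α
    not-invariant invα = T-consistent (to (α-truth 1) (to inv (from (α-truth 0) left-T))) right-T
      where
      α-truth : ∀ a → (limit , cls a ⊨ᶠ α) ⇔ Holdsᵀ (a ∷ []) α
      α-truth a = truth α id id (a ∷ [])
      inv : (limit , cls 0 ⊨ᶠ α) ⇔ (limit , cls 1 ⊨ᶠ α)
      inv = invα _ _ _ _ (bisimilar-via (id-boundedMorphism limit) (Z-bisimulation start-related) start-related)
      left-T : Holdsᵀ (0 ∷ []) α
      left-T = T-start λ A ρ (l , _) → subst (λ x → model A , x ⊨ᶠ α) (sym l) (left⊨ A)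
      right-T : Holdsᵀ (1 ∷ []) (¬̇ α)
      right-T = T-start λ A ρ (_ , r) h → right⊭ A (subst (λ x → model A , x ⊨ᶠ α) r h)

  -- The two points of a failure of preservation are moved into one disjoint union.
  failure : BisimulationInvariant α → ∀ n {M s N t} → Agree (D n) M s N t →
            M , s ⊨ᶠ α → ¬ (N , t ⊨ᶠ α) → ∃[ A ] n ≤ rank A
  failure invα n {M} {s} {N} {t} a s⊨α t⊭α = record
    { rank   = n
    ; model  = M ⊎ᴹ N
    ; left   = inj₁ s
    ; right  = inj₂ t
    ; agree  = λ φ φ∈ → boundedMorphism-⊨ (inj₂-boundedMorphism M N) φ ⇔-∘
                        (a φ φ∈ ⇔-∘ ⇔-sym (boundedMorphism-⊨ (inj₁-boundedMorphism M N) φ))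
    ; left⊨  = to (invariant-boundedMorphism α invα (inj₁-boundedMorphism M N) s) s⊨α
    ; right⊭ = t⊭α ∘ from (invariant-boundedMorphism α invα (inj₂-boundedMorphism M N) t)
    } , ℕ.≤-refl

  invariant⇒definable : BisimulationInvariant α → ∃[ ψ ] EquivalentTo α ψ
  -- If no approximant has rank `n` or more, then by `failure` agreement on `D n` preserves `α`;
  -- otherwise ranks are unbounded and the limit model refutes invariance.
  invariant⇒definable invα with em {∃[ n ] ¬ (∃[ A ] n ≤ rank A)}
  ... | yes (n , none) = agreement-definable em α (D n) λ M s N t a s⊨α →
    decidable-stable (em-lower em) λ t⊭α → none (failure invα n a s⊨α t⊭α)
  ... | no all = contradiction invα
    (not-invariant λ n → decidable-stable em λ none → all (n , none))

theorem29 : ∀ {ℓ} → ExcludedMiddle (suc ℓ) → (P : Set ℓ) → P →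
    (α : FO P 1) →
    (∃[ ψ ] EquivalentTo α ψ) ⇔ BisimulationInvariant α
theorem29 em P p₀ α = mk⇔
  (λ (ψ , e) → definable⇒invariant (em-lower em) α ψ e)
  (Limit.invariant⇒definable em p₀ α)
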